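{- Let $\mathcal R$ be a top tree of height $h$ over $(T,\partial T)$, and let $\mathrm{select}$ be any function that, given a root cluster with two children, returns one of them. If $|\partial T|\le 1$, then after $O(h)$ calls to $\mathrm{select}$, $\mathrm{join}$ and $\mathrm{split}$ there is a unique edge $(v,w)$ contained in every cluster chosen by $\mathrm{select}$, and this edge is returned; afterwards the top tree is restored to its original state with $O(h)$ calls to $\mathrm{join}$ and $\mathrm{split}$. Here the search proceeds down $\mathcal R$: while the current cluster $C$ of $\mathcal R$ (initially the root) is not a single edge, with children $A,B$ in $\mathcal R$, $\mathrm{select}$ is called on a root cluster $\mathrm{join}(A^*,B^*)$ with $A\subseteq A^*$, $B\subseteq B^*$, $A^*\cup B^*=T$, and the new current cluster is $A$ or $B$ according to whether $A^*$ or $B^*$ is selected. If $\partial T=\{x,y\}$ with $x\ne y$, the same process (calling $\mathrm{select}$ only when both children of the current cluster are path children, otherwise descending to the unique path child) ends with a unique edge $(v,w)$ on the path from $x$ to $y$, within the same bounds.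
   Context: Given a tree $T$ and a set $\partial T$ of at most two external boundary vertices, the boundary $\partial C$ of a subtree $C$ is the set of its vertices that are in $\partial T$ or incident to an edge of $T$ not in $C$. A cluster is a subtree with at least one edge and $|\partial C|\le2$. A top tree is a binary tree of clusters whose leaves are the single edges of $T$, whose sibling clusters are edge-disjoint, meet in one vertex and have their union as parent, and whose root is $T$. $\mathrm{join}(A,B)$ creates a new root $A\cup B$ over two neighboring root clusters; $\mathrm{split}(C)$ removes a root $C$ leaving its children as roots. If $|\partial C|=2$, its cluster path is the path between its two boundary vertices; a child $A$ of $C$ is a path child if it shares an edge with the cluster path of $C$. -}

module Defs where

open import Data.Fin using (Fin)
open import Data.Fin.Properties using (any?; _≟_)
open import Data.Fin.Subset using (Subset; _∈_; _⊆_; _∩_; _∪_; ∁; ⊤; ⁅_⁆; ∣_∣; Empty; Nonempty)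
open import Data.Fin.Subset.Properties using (_∈?_)
open import Data.List using (List; []; _∷_; [_])
import Data.List.Membership.Propositional as List
open import Data.List.Relation.Binary.Permutation.Propositional using (_↭_)
open import Data.List.Relation.Unary.All using (All)
open import Data.List.Relation.Unary.Unique.Propositional using (Unique)
open import Data.Nat using (ℕ; suc; _+_; _≤_; _⊔_)
open import Data.Product using (Σ; ∃; ∃₂; _×_; _,_; proj₁; proj₂)
open import Data.Sum using (_⊎_)
open import Data.Vec using (tabulate)
open import Relation.Binary.Construct.Closure.ReflexiveTransitive using (Star; ε; _◅_; fold)
open import Relation.Binary.PropositionalEquality using (_≡_; _≢_)
open import Relation.Nullary using (Dec; does; ¬_)
open import Relation.Nullary.Decidable using (_×-dec_; _⊎-dec_)

-- Edges are labelled by Fin m; the pair of endpoints of an edge carries no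
-- orientation.
record Graph (n m : ℕ) : Set where
  field
    ends     : Fin m → Fin n × Fin n
    loopless : ∀ e → proj₁ (ends e) ≢ proj₂ (ends e)

module Walks {n m : ℕ} (G : Graph n m) where
  open Graph G

  Joins : Fin m → Fin n → Fin n → Set
  Joins e u v = ends e ≡ (u , v) ⊎ ends e ≡ (v , u)

  Adjacent : Subset m → Fin n → Fin n → Set
  Adjacent C u v = ∃ λ e → e ∈ C × Joins e u v

  Walk : Subset m → Fin n → Fin n → Set
  Walk C = Star (Adjacent C)

  vertices : ∀ {C u v} → Walk C u v → List (Fin n)
  vertices {u = u} ε       = [ u ]
  vertices {u = u} (_ ◅ w) = u ∷ vertices w

  edges : ∀ {C u v} → Walk C u v → List (Fin m)
  edges ε             = []
  edges ((e , _) ◅ w) = e ∷ edges w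

  Path : Fin n → Fin n → Set
  Path u v = Σ (Walk ⊤ u v) λ w → Unique (vertices w)

  Incident : Fin m → Fin n → Set
  Incident e v = v ≡ proj₁ (ends e) ⊎ v ≡ proj₂ (ends e)

  incident? : ∀ e v → Dec (Incident e v)
  incident? e v = (v ≟ proj₁ (ends e)) ⊎-dec (v ≟ proj₂ (ends e))

  -- The vertices of the subgraph with edge set C.
  V : Subset m → Subset n
  V C = tabulate λ v → does (any? λ e → (e ∈? C) ×-dec incident? e v)

-- A graph in which any two vertices are joined by exactly one path.  Uniqueness
-- is stated on edges, so it also excludes parallel edges.
record Tree (n m : ℕ) : Set where
  field
    graph : Graph n m
  open Walks graph
  field
    path   : ∀ u v → Path u v
    unique : ∀ {u v} (p q : Path u v) → edges (proj₁ p) ≡ edges (proj₁ q)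

  pathEdges : Fin n → Fin n → List (Fin m)
  pathEdges u v = edges (proj₁ (path u v))

-- A bare hierarchy of edge sets; IsTopTree below adds the conditions on its nodes.
infix 6 _▵_

data Binary (m : ℕ) : Set where
  leaf : Fin m → Binary m
  _▵_  : Binary m → Binary m → Binary m

cluster : ∀ {m} → Binary m → Subset m
cluster (leaf e) = ⁅ e ⁆
cluster (A ▵ B)  = cluster A ∪ cluster B

height : ∀ {m} → Binary m → ℕ
height (leaf _) = 0
height (A ▵ B)  = suc (height A ⊔ height B)

data Choice : Set where
  first second : Choice

pick : ∀ {A : Set} → Choice → A → A → A
pick first  a _ = a
pick second _ b = b

-- The arguments are the two children of the given root cluster.
Select : ℕ → Set
Select m = Binary m → Binary m → Choice

module TopTrees {n m : ℕ} (T : Tree n m) (∂T : Subset n) where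
  open Tree T
  open Walks graph

  -- Subtrees with at least one edge are represented by their edge sets; a vertex
  -- is incident to an edge outside C exactly when it lies in V (∁ C).
  ∂ : Subset m → Subset n
  ∂ C = V C ∩ (∂T ∪ V (∁ C))

  Connected : Subset m → Set
  Connected C = ∀ {u v} → u ∈ V C → v ∈ V C → Walk C u v

  IsCluster : Subset m → Set
  IsCluster C = Nonempty C × Connected C × ∣ ∂ C ∣ ≤ 2

  Neighbours : Subset m → Subset m → Set
  Neighbours C D = Empty (C ∩ D) × ∣ V C ∩ V D ∣ ≡ 1

  -- The subtree of a top tree below any of its nodes, as a hierarchy of its own.
  data Valid : Binary m → Set where
    leaf : ∀ {e} → IsCluster ⁅ e ⁆ → Valid (leaf e)
    node : ∀ {A B} → Valid A → Valid B → Neighbours (cluster A) (cluster B) →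
           IsCluster (cluster (A ▵ B)) → Valid (A ▵ B)

  IsTopTree : Binary m → Set
  IsTopTree R = Valid R × cluster R ≡ ⊤

  PathChild : (C A : Subset m) → Set
  PathChild C A = ∃₂ λ a b → a ≢ b × ∂ C ≡ ⁅ a ⁆ ∪ ⁅ b ⁆ ×
                  ∃ λ e → e ∈ A × e List.∈ pathEdges a b

  -- The current root clusters, each with the hierarchy below it, in no
  -- particular order.
  Forest : Set
  Forest = List (Binary m)

  data Step (F : Forest) : Forest → Set where
    join  : ∀ {A B G} → F ↭ A ∷ B ∷ G → Neighbours (cluster A) (cluster B) →
            IsCluster (cluster (A ▵ B)) → Step F ((A ▵ B) ∷ G)
    split : ∀ {A B G} → F ↭ (A ▵ B) ∷ G → Step F (A ∷ B ∷ G)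

  Steps : Forest → Forest → Set
  Steps = Star Step

  count : ∀ {F G} → Steps F G → ℕ
  count = fold (λ _ _ → ℕ) (λ _ → suc) 0

  -- Search F C is a search strategy from the forest F with current cluster C.
  -- It consults select only through its answers: a call of select has one
  -- continuation for each of them.  The current cluster is a node of the original
  -- top tree and need not be a root of F.
  data Search (F : Forest) : Binary m → Set where
    found : ∀ {e} → Search F (leaf e)
    call  : ∀ {A B A* B* F′} →
            ∣ ∂T ∣ ≤ 1 ⊎ (PathChild (cluster (A ▵ B)) (cluster A) ×
                          PathChild (cluster (A ▵ B)) (cluster B)) →
            Steps F F′ →
            (A* ▵ B*) List.∈ F′ →
            cluster A ⊆ cluster A* → cluster B ⊆ cluster B* →
            cluster A* ∪ cluster B* ≡ ⊤ →
            (∀ s → Search F′ (pick s A B)) →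
            Search F (A ▵ B)
    descend₁ : ∀ {A B} → ∣ ∂T ∣ ≡ 2 →
               PathChild (cluster (A ▵ B)) (cluster A) →
               ¬ PathChild (cluster (A ▵ B)) (cluster B) →
               Search F A → Search F (A ▵ B)
    descend₂ : ∀ {A B} → ∣ ∂T ∣ ≡ 2 →
               ¬ PathChild (cluster (A ▵ B)) (cluster A) →
               PathChild (cluster (A ▵ B)) (cluster B) →
               Search F B → Search F (A ▵ B)

  record Outcome : Set where
    constructor outcome
    field
      returned : Fin m
      chosen   : List (Subset m)
      calls    : ℕ
      final    : Forest
  open Outcome public

  -- calls counts the calls to select, join and split together.
  run : ∀ {F C} → Select m → Search F C → Outcome
  run {F} select (found {e}) = outcome e [] 0 F
  run select (call {A* = A*} {B*} _ ops _ _ _ _ continue) =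
    let s = select A* B*
        o = run select (continue s)
    in outcome (returned o) (cluster (pick s A* B*) ∷ chosen o)
               (count ops + suc (calls o)) (final o)
  run select (descend₁ _ _ _ next) = run select next
  run select (descend₂ _ _ _ next) = run select next

  -- For every select function, the strategy performs at most b calls, returns the
  -- one edge satisfying P that lies in all chosen clusters, and can then be
  -- undone by at most b calls to join and split.
  Solves : (P : Fin m → Set) (b : ℕ) (R : Binary m) → Search [ R ] R → Set
  Solves P b R search = ∀ (select : Select m) →
    let o = run select search
        Common : Fin m → Set
        Common e = P e × All (e ∈_) (chosen o)
    in calls o ≤ b ×
       Common (returned o) ×
       (∀ e → Common e → e ≡ returned o) ×
       Σ (Steps (final o) [ R ]) λ ops → count ops ≤ b

{-# OPTIONS --safe #-}

-- While C is the current cluster, T is cut into C and at most two outside parts,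
-- attached to C at distinct boundary vertices.  Splitting C = A ∪ B and giving
-- each child at most one part yields A* and B*, which partition T.  A cluster X
-- whose complement Y is also connected meets it in a single vertex, so ∂X is that
-- vertex together with the vertices of ∂T in X; if ∂T = {x, y}, then X contains
-- only one of x and y unless it contains the path between them, which is excluded
-- when Y has an edge of that path.  A* and B* being disjoint, an edge of A ∪ B in
-- the chosen one of them belongs to the corresponding child, hence the
-- uniqueness.  Restoring the top tree means reversing the steps.
module Submission where

open import Defs
open import Data.Fin using (Fin)
open import Data.Fin.Subset using (Subset; _∪_; ⁅_⁆; ∣_∣)
open import Data.List.Membership.Propositional using (_∈_)
open import Data.Nat using (ℕ; _≤_; _*_)
open import Data.Product using (Σ; ∃; _×_)
open import Data.Unit using (⊤)
open import Relation.Binary.PropositionalEquality using (_≡_; _≢_)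

open import Data.Empty using (⊥; ⊥-elim)
open import Data.Fin.Properties using (any?; _≟_)
open import Data.Fin.Subset using (inside; outside; _∩_; ∁; _-_; _⊆_; Nonempty) renaming (_∈_ to _∈ˢ_; ⊤ to full)
open import Data.Fin.Subset.Properties
open import Data.List using ([]; _∷_; [_]; _++_)
import Data.List.Membership.DecPropositional as DecMembership
open import Data.List.Relation.Binary.Permutation.Propositional using (_↭_; ↭-refl; ↭-prep; ↭-swap; ↭-sym; ↭-trans)
open import Data.List.Relation.Binary.Permutation.Propositional.Properties
  using (All-resp-↭; ↭-singleton-inv; ++-comm; shift)
open import Data.List.Relation.Unary.All using (All; []; _∷_)
open import Data.List.Relation.Unary.All.Properties using (¬Any⇒All¬)
open import Data.List.Relation.Unary.AllPairs using ([]; _∷_)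
open import Data.List.Relation.Unary.Any using (here; there)
open import Data.List.Relation.Unary.Unique.Propositional using (Unique)
open import Data.Nat using (suc; _+_; _<_; _⊔_; z≤n; s≤s)
open import Data.Nat.Properties
  using (≤-refl; ≤-trans; ≤-reflexive; ≤-antisym; ≤-<-trans; <⇒≱; m≤m+n; m≤m⊔n; m≤n⊔m; m≤n⇒m≤1+n;
         +-mono-≤; +-monoˡ-≤; +-monoʳ-≤; *-monoʳ-≤; +-suc; +-assoc; +-comm; *-suc)
open import Data.Product using (_,_; proj₁; proj₂)
open import Data.Sum using (_⊎_; inj₁; inj₂; [_,_]′; swap)
open import Data.Unit using (tt)
open import Data.Vec using ([]; _∷_; tabulate)
open import Data.Vec.Properties using (lookup∘tabulate; lookup⇒[]=; []=⇒lookup)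
open import Function using (_∘_; id)
open import Relation.Binary.Construct.Closure.ReflexiveTransitive as Star using (ε; _◅_; _◅◅_)
open import Relation.Binary.PropositionalEquality using (refl; sym; trans; cong; subst)
open import Relation.Nullary using (Dec; yes; no; does; ¬_; contradiction)
open import Relation.Nullary.Decidable using (dec-true; _×-dec_)

-- Finite subsets and their sizes.

module _ {n : ℕ} {P : Fin n → Set} (P? : ∀ x → Dec (P x)) where

  ∈-tabulate⁺ : ∀ {x} → P x → x ∈ˢ tabulate (does ∘ P?)
  ∈-tabulate⁺ {x} px = lookup⇒[]= x _ (trans (lookup∘tabulate _ x) (dec-true (P? x) px))

  ∈-tabulate⁻ : ∀ {x} → x ∈ˢ tabulate (does ∘ P?) → P x
  ∈-tabulate⁻ {x} x∈ with P? x | trans (sym (lookup∘tabulate (does ∘ P?) x)) ([]=⇒lookup x∈)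
  ... | yes px | _ = px

∣p∪q∣≤∣p∣+∣q∣ : ∀ {n} (p q : Subset n) → ∣ p ∪ q ∣ ≤ ∣ p ∣ + ∣ q ∣
∣p∪q∣≤∣p∣+∣q∣ []            []            = z≤n
∣p∪q∣≤∣p∣+∣q∣ (outside ∷ p) (outside ∷ q) = ∣p∪q∣≤∣p∣+∣q∣ p q
∣p∪q∣≤∣p∣+∣q∣ (inside ∷ p)  (outside ∷ q) = s≤s (∣p∪q∣≤∣p∣+∣q∣ p q)
∣p∪q∣≤∣p∣+∣q∣ (outside ∷ p) (inside ∷ q)
  rewrite +-suc ∣ p ∣ ∣ q ∣ = s≤s (∣p∪q∣≤∣p∣+∣q∣ p q)
∣p∪q∣≤∣p∣+∣q∣ (inside ∷ p)  (inside ∷ q)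
  rewrite +-suc ∣ p ∣ ∣ q ∣ = s≤s (m≤n⇒m≤1+n (∣p∪q∣≤∣p∣+∣q∣ p q))

module _ {n : ℕ} {p : Subset n} where

  -- Deleting a member strictly lowers the size, so every further distinct member raises the lower
  -- bound by one.
  two-members : ∀ {a b} → a ≢ b → a ∈ˢ p → b ∈ˢ p → 2 ≤ ∣ p ∣
  two-members a≢b a∈p b∈p =
    ≤-<-trans (≤-<-trans z≤n (x∈p⇒∣p-x∣<∣p∣ (x∈p∧x≢y⇒x∈p-y b∈p (a≢b ∘ sym)))) (x∈p⇒∣p-x∣<∣p∣ a∈p)

  no-third-member : ∀ {a b c} → ∣ p ∣ ≤ 2 → a ≢ b → a ∈ˢ p → b ∈ˢ p → c ∈ˢ p → c ≡ a ⊎ c ≡ b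
  no-third-member {a} {b} {c} ∣p∣≤2 a≢b a∈p b∈p c∈p with c ≟ a | c ≟ b
  ... | yes c≡a | _       = inj₁ c≡a
  ... | no _    | yes c≡b = inj₂ c≡b
  ... | no c≢a  | no c≢b  = contradiction ∣p∣≤2 (<⇒≱ 3≤∣p∣)
    where
    b∈p-a : b ∈ˢ p - a
    b∈p-a = x∈p∧x≢y⇒x∈p-y b∈p (a≢b ∘ sym)
    c∈p-a-b : c ∈ˢ (p - a) - b
    c∈p-a-b = x∈p∧x≢y⇒x∈p-y (x∈p∧x≢y⇒x∈p-y c∈p c≢a) c≢b
    3≤∣p∣ : 2 < ∣ p ∣
    3≤∣p∣ = ≤-<-trans (≤-<-trans (≤-<-trans z≤n (x∈p⇒∣p-x∣<∣p∣ c∈p-a-b))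
                                (x∈p⇒∣p-x∣<∣p∣ b∈p-a)) (x∈p⇒∣p-x∣<∣p∣ a∈p)

  members : ∀ {a b} → ∣ p ∣ ≤ 2 → a ≢ b → a ∈ˢ p → b ∈ˢ p → p ≡ ⁅ a ⁆ ∪ ⁅ b ⁆
  members {a} {b} ∣p∣≤2 a≢b a∈p b∈p = ⊆-antisym ⊆₁ ⊆₂
    where
    ⊆₁ : p ⊆ ⁅ a ⁆ ∪ ⁅ b ⁆
    ⊆₁ c∈p with no-third-member ∣p∣≤2 a≢b a∈p b∈p c∈p
    ... | inj₁ refl = x∈p∪q⁺ (inj₁ (x∈⁅x⁆ a))
    ... | inj₂ refl = x∈p∪q⁺ (inj₂ (x∈⁅x⁆ b))
    ⊆₂ : ⁅ a ⁆ ∪ ⁅ b ⁆ ⊆ p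
    ⊆₂ c∈ with x∈p∪q⁻ ⁅ a ⁆ ⁅ b ⁆ c∈
    ... | inj₁ c∈a = subst (_∈ˢ p) (sym (x∈⁅y⁆⇒x≡y a c∈a)) a∈p
    ... | inj₂ c∈b = subst (_∈ˢ p) (sym (x∈⁅y⁆⇒x≡y b c∈b)) b∈p

-- Walks, simple paths and vertex sets in a tree.

module TreeWalks {n m : ℕ} (T : Tree n m) where
  open Tree T
  open Walks graph

  ∈V⁺ : ∀ {C e v} → e ∈ˢ C → Incident e v → v ∈ˢ V C
  ∈V⁺ {C} {e} e∈C e-v = ∈-tabulate⁺ (λ v → any? λ e → (e ∈? C) ×-dec incident? e v) (e , e∈C , e-v)

  ∈V⁻ : ∀ {C v} → v ∈ˢ V C → ∃ λ e → e ∈ˢ C × Incident e v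
  ∈V⁻ {C} = ∈-tabulate⁻ (λ v → any? λ e → (e ∈? C) ×-dec incident? e v)

  V-mono : ∀ {C D} → C ⊆ D → V C ⊆ V D
  V-mono C⊆D v∈V with _ , e∈C , e-v ← ∈V⁻ v∈V = ∈V⁺ (C⊆D e∈C) e-v

  V-∪⁻ : ∀ C D {v} → v ∈ˢ V (C ∪ D) → v ∈ˢ V C ⊎ v ∈ˢ V D
  V-∪⁻ C D v∈V with _ , e∈ , e-v ← ∈V⁻ v∈V with x∈p∪q⁻ C D e∈
  ... | inj₁ e∈C = inj₁ (∈V⁺ e∈C e-v)
  ... | inj₂ e∈D = inj₂ (∈V⁺ e∈D e-v)

  incidentˡ : ∀ {e u v} → Joins e u v → Incident e u
  incidentˡ (inj₁ p) = inj₁ (cong proj₁ (sym p))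
  incidentˡ (inj₂ p) = inj₂ (cong proj₂ (sym p))

  incidentʳ : ∀ {e u v} → Joins e u v → Incident e v
  incidentʳ = incidentˡ ∘ swap

  incidents : ∀ {e u v} → Joins e u v → ∀ {z} → Incident e z → z ≡ u ⊎ z ≡ v
  incidents (inj₁ p) (inj₁ q) = inj₁ (trans q (cong proj₁ p))
  incidents (inj₁ p) (inj₂ q) = inj₂ (trans q (cong proj₂ p))
  incidents (inj₂ p) (inj₁ q) = inj₂ (trans q (cong proj₁ p))
  incidents (inj₂ p) (inj₂ q) = inj₁ (trans q (cong proj₂ p))

  widen : ∀ {C D u v} → C ⊆ D → Walk C u v → Walk D u v
  widen C⊆D = Star.map λ (e , e∈C , j) → e , C⊆D e∈C , j

  reverse : ∀ {C u v} → Walk C u v → Walk C v u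
  reverse = Star.reverse λ (e , e∈C , j) → e , e∈C , swap j

  edges∈ : ∀ {C u v e} (w : Walk C u v) → e ∈ edges w → e ∈ˢ C
  edges∈ ((_ , e∈C , _) ◅ w) (here refl) = e∈C
  edges∈ (_ ◅ w)             (there e∈w) = edges∈ w e∈w

  Simple : ∀ {C u v} → Walk C u v → Set
  Simple w = Unique (vertices w)

  vertices-widen : ∀ {C D u v} (C⊆D : C ⊆ D) (w : Walk C u v) → vertices (widen C⊆D w) ≡ vertices w
  vertices-widen C⊆D ε       = refl
  vertices-widen C⊆D (_ ◅ w) = cong (_ ∷_) (vertices-widen C⊆D w)

  edges-widen : ∀ {C D u v} (C⊆D : C ⊆ D) (w : Walk C u v) → edges (widen C⊆D w) ≡ edges w
  edges-widen C⊆D ε       = refl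
  edges-widen C⊆D (_ ◅ w) = cong (_ ∷_) (edges-widen C⊆D w)

  suffix-from : ∀ {C u v x} (w : Walk C u v) → Simple w → x ∈ vertices w → ∃ λ (w′ : Walk C x v) → Simple w′
  suffix-from ε       s       (here refl) = ε , s
  suffix-from (a ◅ w) s       (here refl) = a ◅ w , s
  suffix-from (a ◅ w) (_ ∷ s) (there x∈w) = suffix-from w s x∈w

  -- Loop erasure: if the start recurs in the shortened tail, only the part from that occurrence on
  -- is kept.
  simplify : ∀ {C u v} → Walk C u v → ∃ λ (w : Walk C u v) → Simple w
  simplify ε = ε , [] ∷ []
  simplify {u = u} (a ◅ w) with w′ , s ← simplify w with DecMembership._∈?_ _≟_ u (vertices w′)
  ... | yes u∈w′ = suffix-from w′ s u∈w′
  ... | no u∉w′  = a ◅ w′ , ¬Any⇒All¬ _ u∉w′ ∷ s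

  edges≡pathEdges : ∀ {C u v} (w : Walk C u v) → Simple w → edges w ≡ pathEdges u v
  edges≡pathEdges w s =
    trans (sym (edges-widen ⊆⊤ w)) (unique (widen ⊆⊤ w , subst Unique (sym (vertices-widen ⊆⊤ w)) s) (path _ _))

  -- A walk shortens to a simple one without leaving `C`, and uniqueness of paths identifies its
  -- edges with those of the tree path. Connected sets therefore contain the tree paths between
  -- their vertices.
  pathEdges⊆ : ∀ {C u v e} → Walk C u v → e ∈ pathEdges u v → e ∈ˢ C
  pathEdges⊆ w e∈p with w′ , s ← simplify w = edges∈ w′ (subst (_ ∈_) (sym (edges≡pathEdges w′ s)) e∈p)

  pathEdges-nonempty : ∀ {u v} → u ≢ v → ∃ λ e → e ∈ pathEdges u v
  pathEdges-nonempty {u} {v} u≢v with path u v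
  ... | ε , _           = contradiction refl u≢v
  ... | (e , _) ◅ _ , _ = e , here refl

  pathEdges⇒≢ : ∀ {u v e} → e ∈ pathEdges u v → u ≢ v
  pathEdges⇒≢ {u} e∈p refl with () ← subst (_ ∈_) (sym (edges≡pathEdges {C = full} (ε {x = u}) ([] ∷ []))) e∈p

  restrict : ∀ {C D u v} (w : Walk C u v) → (∀ {e} → e ∈ edges w → e ∈ˢ D) → Walk D u v
  restrict ε                 _ = ε
  restrict ((e , _ , j) ◅ w) h = (e , h (here refl) , j) ◅ restrict w (h ∘ there)

  -- The path from `v` to `u`, reversed, is a walk within its own edge set, so that set contains the
  -- path from `u` to `v`. This avoids showing that the reversal is simple.
  pathEdges-sym : ∀ {u v e} → e ∈ pathEdges u v → e ∈ pathEdges v u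
  pathEdges-sym {u} {v} e∈p =
    ∈-tabulate⁻ on-path? (pathEdges⊆ (reverse (restrict (proj₁ (path v u)) (∈-tabulate⁺ on-path?))) e∈p)
    where
    on-path? : ∀ f → Dec (f ∈ pathEdges v u)
    on-path? f = DecMembership._∈?_ _≟_ f (pathEdges v u)

  module _ (C : Subset m) where

    -- The shortened path starts with the first edge of the original one that lies in C.
    trim-walk : ∀ {u v e} (w : Walk full u v) → Simple w → e ∈ˢ C → e ∈ edges w →
      ∃ λ a → ∃ λ (w′ : Walk full a v) → Simple w′ × a ∈ˢ V C × (a ≡ u ⊎ a ∈ˢ V (∁ C)) ×
        (∀ {f} → f ∈ˢ C → f ∈ edges w → f ∈ edges w′) × (∀ {f} → f ∈ edges w′ → f ∈ edges w)
    trim-walk w@((f , _ , j) ◅ w₁) s@(_ ∷ s₁) e∈C e∈w with f ∈? C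
    ... | yes f∈C = _ , w , s , ∈V⁺ f∈C (incidentˡ j) , inj₁ refl , (λ _ f∈w → f∈w) , id
    ... | no f∉C with e∈w
    ...   | here refl = contradiction e∈C f∉C
    ...   | there e∈w₁ with a , w′ , s′ , a∈V , a-end , keeps , sub ← trim-walk w₁ s₁ e∈C e∈w₁ =
            a , w′ , s′ , a∈V , inj₂ ([ (λ { refl → ∈V⁺ (x∉p⇒x∈∁p f∉C) (incidentʳ j) }) , id ]′ a-end) ,
            (λ { g∈C (here refl) → contradiction g∈C f∉C ; g∈C (there g∈w₁) → keeps g∈C g∈w₁ }) , there ∘ sub

    -- `at-end` offers the two ways for `end` to be a boundary vertex of `C`: as an external one,
    -- when `u` is in `∂T`, or through an incident edge outside `C`.
    record Trimmed (u v : Fin n) : Set where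
      constructor trimmed
      field
        {end}  : Fin n
        end∈V  : end ∈ˢ V C
        at-end : end ≡ u ⊎ end ∈ˢ V (∁ C)
        keeps  : ∀ {f} → f ∈ˢ C → f ∈ pathEdges u v → f ∈ pathEdges end v
        within : ∀ {f} → f ∈ pathEdges end v → f ∈ pathEdges u v

    trim : ∀ {u v e} → e ∈ˢ C → e ∈ pathEdges u v → Trimmed u v
    trim {u} {v} e∈C e∈p =
      let w , s = path u v
          _ , w′ , s′ , a∈V , a-end , keeps , sub = trim-walk w s e∈C e∈p
          w′≡path = edges≡pathEdges w′ s′
      in trimmed a∈V a-end (λ f∈C f∈w → subst (_ ∈_) w′≡path (keeps f∈C f∈w))
                           (λ f∈p → sub (subst (_ ∈_) (sym w′≡path) f∈p))

-- Disjoint and covering edge sets.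

Disjoint : ∀ {m} → Subset m → Subset m → Set
Disjoint C D = ∀ {e} → e ∈ˢ C → e ∈ˢ D → ⊥

Covering : ∀ {m} → Subset m → Subset m → Set
Covering C D = ∀ e → e ∈ˢ C ⊎ e ∈ˢ D

module _ {m : ℕ} where

  disjoint-sym : {C D : Subset m} → Disjoint C D → Disjoint D C
  disjoint-sym C∩D e∈D e∈C = C∩D e∈C e∈D

  disjoint-∪ˡ : ∀ {C D E : Subset m} → Disjoint C E → Disjoint D E → Disjoint (C ∪ D) E
  disjoint-∪ˡ C∩E D∩E e∈ e∈E = [ (λ e∈C → C∩E e∈C e∈E) , (λ e∈D → D∩E e∈D e∈E) ]′ (x∈p∪q⁻ _ _ e∈)

  disjoint-∪ʳ : ∀ {C D E : Subset m} → Disjoint C D → Disjoint C E → Disjoint C (D ∪ E)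
  disjoint-∪ʳ C∩D C∩E = disjoint-sym (disjoint-∪ˡ (disjoint-sym C∩D) (disjoint-sym C∩E))

  disjoint-⊆ˡ : {C D E : Subset m} → C ⊆ D → Disjoint D E → Disjoint C E
  disjoint-⊆ˡ C⊆D D∩E e∈C = D∩E (C⊆D e∈C)

  ⊆-∪ˡ : {C D : Subset m} → C ⊆ C ∪ D
  ⊆-∪ˡ e∈C = x∈p∪q⁺ (inj₁ e∈C)

  ⊆-∪ʳ : {C D : Subset m} → D ⊆ C ∪ D
  ⊆-∪ʳ e∈D = x∈p∪q⁺ (inj₂ e∈D)

  covering⇒∪≡⊤ : {C D : Subset m} → Covering C D → C ∪ D ≡ full
  covering⇒∪≡⊤ C+D = ⊆-antisym ⊆⊤ λ {e} _ → x∈p∪q⁺ (C+D e)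

-- Clusters, cuts and their boundaries.

module Clusters {n m : ℕ} (T : Tree n m) (∂T : Subset n) where
  open Tree T
  open Walks graph
  open TopTrees T ∂T
  open TreeWalks T

  Touching : Subset m → Subset m → Set
  Touching C D = ∃ λ z → z ∈ˢ V C × z ∈ˢ V D

  -- The tree path between two distinct shared vertices would lie in both connected sets and give
  -- them a common edge.
  shared-vertex-unique : ∀ {C D u v} → Connected C → Connected D → Disjoint C D →
    u ∈ˢ V C → u ∈ˢ V D → v ∈ˢ V C → v ∈ˢ V D → u ≡ v
  shared-vertex-unique {u = u} {v} cC cD C∩D uC uD vC vD with u ≟ v
  ... | yes u≡v = u≡v
  ... | no u≢v with _ , e∈p ← pathEdges-nonempty u≢v =
    ⊥-elim (C∩D (pathEdges⊆ (cC uC vC) e∈p) (pathEdges⊆ (cD uD vD) e∈p))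

  neighbours⁺ : ∀ {C D} → Connected C → Connected D → Disjoint C D → Touching C D → Neighbours C D
  neighbours⁺ {C} {D} cC cD C∩D (z , zC , zD) =
    (λ (_ , e∈) → let e∈C , e∈D = x∈p∩q⁻ C D e∈ in C∩D e∈C e∈D) ,
    trans (cong ∣_∣ (⊆-antisym ⊆z z⊆)) (∣⁅x⁆∣≡1 z)
    where
    ⊆z : V C ∩ V D ⊆ ⁅ z ⁆
    ⊆z x∈ with xC , xD ← x∈p∩q⁻ (V C) (V D) x∈
      rewrite shared-vertex-unique cC cD C∩D xC xD zC zD = x∈⁅x⁆ z
    z⊆ : ⁅ z ⁆ ⊆ V C ∩ V D
    z⊆ x∈ rewrite x∈⁅y⁆⇒x≡y z x∈ = x∈p∩q⁺ (zC , zD)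

  neighbours⇒disjoint : ∀ {C D} → Neighbours C D → Disjoint C D
  neighbours⇒disjoint (C∩D , _) e∈C e∈D = C∩D (_ , x∈p∩q⁺ (e∈C , e∈D))

  neighbours⇒touching : ∀ {C D} → Neighbours C D → Touching C D
  neighbours⇒touching {C} {D} (_ , one) with nonempty? (V C ∩ V D)
  ... | yes (z , z∈) = z , x∈p∩q⁻ (V C) (V D) z∈
  ... | no none with () ← trans (sym one) (trans (cong ∣_∣ (Empty-unique none)) (∣⊥∣≡0 n))

  connected-∪ : ∀ {C D} → Connected C → Connected D → Touching C D → Connected (C ∪ D)
  connected-∪ {C} {D} cC cD (z , zC , zD) u∈ v∈ = to-z u∈ ◅◅ reverse (to-z v∈)
    where
    to-z : ∀ {u} → u ∈ˢ V (C ∪ D) → Walk (C ∪ D) u z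
    to-z u∈ with V-∪⁻ C D u∈
    ... | inj₁ uC = widen ⊆-∪ˡ (cC uC zC)
    ... | inj₂ uD = widen ⊆-∪ʳ (cD uD zD)

  -- A boundary vertex of X outside ∂T lies on both sides of the cut, and a tree
  -- has only one such vertex.
  ∣∂∣≤2-cut : ∀ {X Y} → Connected X → Connected Y → Disjoint X Y → Covering X Y → Touching X Y →
    ∣ V X ∩ ∂T ∣ ≤ 1 → ∣ ∂ X ∣ ≤ 2
  ∣∂∣≤2-cut {X} {Y} cX cY X∩Y X+Y (z , zX , zY) few =
    ≤-trans (p⊆q⇒∣p∣≤∣q∣ ∂X⊆)
      (≤-trans (∣p∪q∣≤∣p∣+∣q∣ (V X ∩ ∂T) ⁅ z ⁆) (+-mono-≤ few (≤-reflexive (∣⁅x⁆∣≡1 z))))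
    where
    ∁X⊆Y : ∁ X ⊆ Y
    ∁X⊆Y {e} e∈∁X = [ (λ e∈X → contradiction e∈X (x∈∁p⇒x∉p e∈∁X)) , id ]′ (X+Y e)
    ∂X⊆ : ∂ X ⊆ (V X ∩ ∂T) ∪ ⁅ z ⁆
    ∂X⊆ x∈ with xX , x∈′ ← x∈p∩q⁻ (V X) _ x∈ with x∈p∪q⁻ ∂T _ x∈′
    ... | inj₁ x∈∂T = ⊆-∪ˡ (x∈p∩q⁺ (xX , x∈∂T))
    ... | inj₂ x∈V∁X
      rewrite shared-vertex-unique cX cY X∩Y xX (V-mono ∁X⊆Y x∈V∁X) zX zY = ⊆-∪ʳ (x∈⁅x⁆ z)

  ∂-full : ∀ {C} → C ≡ full → ∂ C ⊆ ∂T
  ∂-full refl x∈ with x∈p∪q⁻ ∂T _ (proj₂ (x∈p∩q⁻ (V full) _ x∈))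
  ... | inj₁ x∈∂T = x∈∂T
  ... | inj₂ x∈V∁ with _ , e∈∁ , _ ← ∈V⁻ x∈V∁ = contradiction ∈⊤ (x∈∁p⇒x∉p e∈∁)

  -- An edge of `D` at `z` lies outside `C`.
  ∈∂ : ∀ {C D z} → Disjoint C D → z ∈ˢ V C → z ∈ˢ V D → z ∈ˢ ∂ C
  ∈∂ C∩D zC zD = x∈p∩q⁺ (zC , x∈p∪q⁺ (inj₂ (V-mono (λ e∈D → x∉p⇒x∈∁p λ e∈C → C∩D e∈C e∈D) zD)))

  valid⇒cluster : ∀ {C} → Valid C → IsCluster (cluster C)
  valid⇒cluster (leaf c)       = c
  valid⇒cluster (node _ _ _ c) = c

  valid⇒connected : ∀ {C} → Valid C → Connected (cluster C)
  valid⇒connected = proj₁ ∘ proj₂ ∘ valid⇒cluster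

  -- Counted sequences of joins and splits, up to permutation of the forest.

  record Reach (F : Forest) (k : ℕ) (G : Forest) : Set where
    constructor reach
    field
      {target} : Forest
      steps    : Steps F target
      bounded  : count steps ≤ k
      permuted : target ↭ G

  count-◅◅ : ∀ {F G H} (s : Steps F G) (t : Steps G H) → count (s ◅◅ t) ≡ count s + count t
  count-◅◅ ε       t = refl
  count-◅◅ (_ ◅ s) t = cong suc (count-◅◅ s t)

  step-↭ : ∀ {F G H} → F ↭ G → Step G H → Step F H
  step-↭ p (join q ns c) = join (↭-trans p q) ns c
  step-↭ p (split q)     = split (↭-trans p q)

  reach-↭ : ∀ {F G} → F ↭ G → Reach F 0 G
  reach-↭ = reach ε z≤n

  reach-weaken : ∀ {F G k l} → k ≤ l → Reach F k G → Reach F l G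
  reach-weaken k≤l (reach s b p) = reach s (≤-trans b k≤l) p

  infixr 5 _⨾_

  -- A step accepts any permutation of its forest, so a reordering is absorbed by the step after it,
  -- or by the final permutation if there is none, and costs nothing.
  _⨾_ : ∀ {F G H k l} → Reach F k G → Reach G l H → Reach F (k + l) H
  _⨾_ {k = k} {l} (reach s b p) (reach ε c q) = reach s (≤-trans b (m≤m+n k l)) (↭-trans p q)
  reach s b p ⨾ reach (t ◅ ts) c q =
    reach (s ◅◅ (step-↭ p t ◅ ts)) (≤-trans (≤-reflexive (count-◅◅ s _)) (+-mono-≤ b c)) q

  reach-join : ∀ {A B G} → Valid (A ▵ B) → Reach (A ∷ B ∷ G) 1 ((A ▵ B) ∷ G)
  reach-join (node _ _ ns c) = reach (join ↭-refl ns c ◅ ε) ≤-refl ↭-refl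

  reach-split : ∀ {A B G} → Reach ((A ▵ B) ∷ G) 1 (A ∷ B ∷ G)
  reach-split = reach (split ↭-refl ◅ ε) ≤-refl ↭-refl

  valid-step : ∀ {F G} → All Valid F → Step F G → All Valid G
  valid-step vF (join p ns c) with vA ∷ vB ∷ vG ← All-resp-↭ p vF = node vA vB ns c ∷ vG
  valid-step vF (split p) with node vA vB _ _ ∷ vG ← All-resp-↭ p vF = vA ∷ vB ∷ vG

  -- Undoing a split is a join, whose side conditions are read off the validity of the cluster that
  -- was split.
  undo-step : ∀ {F G} → All Valid F → Step F G → Reach G 1 F
  undo-step vF (join p _ _) = reach-split ⨾ reach-↭ (↭-sym p)
  undo-step vF (split p) with vAB ∷ _ ← All-resp-↭ p vF = reach-join vAB ⨾ reach-↭ (↭-sym p)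

  undo : ∀ {F G} → All Valid F → (s : Steps F G) → Reach G (count s) F
  undo vF ε       = reach-↭ ↭-refl
  undo vF (t ◅ s) = reach-weaken (≤-reflexive (+-comm (count s) 1)) (undo (valid-step vF t) s ⨾ undo-step vF t)

  -- The steps between the calls of select are concatenated so that they can be undone together.
  -- `calls` counts select as well, hence the inequality.
  trace : ∀ {F C} select (s : Search F C) →
    ∃ λ (ops : Steps F (final (run select s))) → count ops ≤ calls (run select s)
  trace select found = ε , z≤n
  trace select (call {A* = A*} {B*} _ ops _ _ _ _ continue)
    with ops′ , b ← trace select (continue (select A* B*)) =
    ops ◅◅ ops′ , ≤-trans (≤-reflexive (count-◅◅ ops ops′)) (+-monoʳ-≤ (count ops) (m≤n⇒m≤1+n b))
  trace select (descend₁ _ _ _ next) = trace select next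
  trace select (descend₂ _ _ _ next) = trace select next

-- Target edges and the facts that guide the descent.

module Descent {n m : ℕ} (T : Tree n m) (∂T : Subset n) (∣∂T∣≤2 : ∣ ∂T ∣ ≤ 2) (Target : Fin m → Set) where
  open Tree T
  open Walks graph
  open TopTrees T ∂T
  open TreeWalks T
  open Clusters T ∂T

  Good : Subset m → Set
  Good C = ∃ λ e → e ∈ˢ C × Target e

  good-⊆ : ∀ {C D} → C ⊆ D → Good C → Good D
  good-⊆ C⊆D (e , e∈C , te) = e , C⊆D e∈C , te

  -- The two cases of the theorem differ only in their targets and in these facts. `few` keeps a
  -- cluster cut off from a good one at two boundary vertices; `callable` and `forced` supply the
  -- side conditions of a call and of a descent without one.
  record Guide : Set where
    field
      target?  : ∀ e → Dec (Target e)
      few      : ∀ {C D} → Connected C → Disjoint C D → Good D → ∣ V C ∩ ∂T ∣ ≤ 1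
      callable : ∀ {C A B} → IsCluster C → A ⊆ C → B ⊆ C → Good A → Good B →
                 ∣ ∂T ∣ ≤ 1 ⊎ (PathChild C A × PathChild C B)
      forced   : ∀ {C A B} → IsCluster C → A ⊆ C → B ⊆ C → Nonempty B → Good A → ¬ Good B →
                 ∣ ∂T ∣ ≡ 2 × PathChild C A × ¬ PathChild C B

  -- Outside parts and their distribution over two children.

  data Extended (A : Binary m) : Binary m → Forest → Set where
    alone : Extended A A []
    with-part : ∀ {O} → Valid O → Disjoint (cluster A) (cluster O) → Touching (cluster A) (cluster O) →
                Extended A (A ▵ O) [ O ]

  -- The attachment vertices in `two` must differ: `attached-to-both` counts them as two boundary
  -- vertices, and `regroup` merges parts that would break this.
  data Outside (C : Binary m) : Forest → Set where
    whole : (∀ e → e ∈ˢ cluster C) → Outside C []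
    one   : ∀ {O} → Valid O → Disjoint (cluster C) (cluster O) → Touching (cluster C) (cluster O) →
            Covering (cluster C) (cluster O) → Outside C [ O ]
    two   : ∀ {O₁ O₂} → Valid O₁ → Valid O₂ →
            Disjoint (cluster C) (cluster O₁) → Disjoint (cluster C) (cluster O₂) →
            Disjoint (cluster O₁) (cluster O₂) →
            (t₁ : Touching (cluster C) (cluster O₁)) (t₂ : Touching (cluster C) (cluster O₂)) →
            proj₁ t₁ ≢ proj₁ t₂ → Covering (cluster C) (cluster O₁ ∪ cluster O₂) →
            Outside C (O₁ ∷ O₂ ∷ [])

  extended-⊆ : ∀ {A A* Os} → Extended A A* Os → cluster A ⊆ cluster A*
  extended-⊆ alone             = id
  extended-⊆ (with-part _ _ _) = ⊆-∪ˡ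

  extended-connected : ∀ {A A* Os} → Valid A → Extended A A* Os → Connected (cluster A*)
  extended-connected vA alone              = valid⇒connected vA
  extended-connected vA (with-part vO _ t) = connected-∪ (valid⇒connected vA) (valid⇒connected vO) t

  valid-▵ : ∀ {A B} → Valid A → Valid B → Disjoint (cluster A) (cluster B) → Touching (cluster A) (cluster B) →
    ∣ ∂ (cluster A ∪ cluster B) ∣ ≤ 2 → Valid (A ▵ B)
  valid-▵ vA vB A∩B t bd with (e , e∈A) , cA , _ ← valid⇒cluster vA =
    node vA vB (neighbours⁺ cA cB A∩B t) ((e , ⊆-∪ˡ e∈A) , connected-∪ cA cB t , bd)
    where cB = valid⇒connected vB

  extended-valid : ∀ {A A* Os} → Valid A → Extended A A* Os → ∣ ∂ (cluster A*) ∣ ≤ 2 → Valid A*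
  extended-valid vA alone                _  = vA
  extended-valid vA (with-part vO A∩O t) bd = valid-▵ vA vO A∩O t bd

  extend : ∀ {A A* Os G} → Extended A A* Os → Valid A* → Reach (A ∷ Os ++ G) 1 (A* ∷ G)
  extend alone             _   = reach-weaken z≤n (reach-↭ ↭-refl)
  extend (with-part _ _ _) vA* = reach-join vA*

  retract : ∀ {A A* Os G} → Extended A A* Os → Reach (A* ∷ G) 1 (A ∷ Os ++ G)
  retract alone             = reach-weaken z≤n (reach-↭ ↭-refl)
  retract (with-part _ _ _) = reach-split

  touching-sym : ∀ {C D} → Touching C D → Touching D C
  touching-sym (z , zC , zD) = z , zD , zC

  touching-⊆ : ∀ {C C′ D D′} → C ⊆ C′ → D ⊆ D′ → Touching C D → Touching C′ D′
  touching-⊆ C⊆ D⊆ (z , zC , zD) = z , V-mono C⊆ zC , V-mono D⊆ zD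

  -- Whether `A*` and `B*` are clusters is left open here, since it depends on which of the children
  -- are good.
  record Distribution (A B : Binary m) (Os : Forest) : Set where
    constructor distribution
    field
      {A* B*}   : Binary m
      {GA GB}   : Forest
      extA      : Extended A A* GA
      extB      : Extended B B* GB
      parts     : Os ↭ GA ++ GB
      disjoint* : Disjoint (cluster A*) (cluster B*)
      covering* : Covering (cluster A*) (cluster B*)

  module _ {A B : Binary m} (vA : Valid A) (vB : Valid B) (A-B : Neighbours (cluster A) (cluster B)) where
    private
      a b : Subset m
      a = cluster A
      b = cluster B

      a∩b : Disjoint a b
      a∩b = neighbours⇒disjoint A-B
      a·b : Touching a b
      a·b = neighbours⇒touching A-B

      module _ {O₁ O₂ : Binary m} (v₁ : Valid O₁) (v₂ : Valid O₂)
        (c∩o₁ : Disjoint (a ∪ b) (cluster O₁)) (c∩o₂ : Disjoint (a ∪ b) (cluster O₂))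
        (o₁∩o₂ : Disjoint (cluster O₁) (cluster O₂))
        (cover : Covering (a ∪ b) (cluster O₁ ∪ cluster O₂)) where

        distribute₂ : Touching a (cluster O₁) → Touching b (cluster O₂) → Distribution A B (O₁ ∷ O₂ ∷ [])
        distribute₂ t₁ t₂ = distribution
          (with-part v₁ (disjoint-⊆ˡ ⊆-∪ˡ c∩o₁) t₁) (with-part v₂ (disjoint-⊆ˡ ⊆-∪ʳ c∩o₂) t₂) ↭-refl
          (disjoint-∪ˡ (disjoint-∪ʳ a∩b (disjoint-⊆ˡ ⊆-∪ˡ c∩o₂))
                       (disjoint-∪ʳ (disjoint-sym (disjoint-⊆ˡ ⊆-∪ʳ c∩o₁)) o₁∩o₂))
          cover*
          where
          cover* : Covering (a ∪ cluster O₁) (b ∪ cluster O₂)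
          cover* e with cover e
          cover* e | inj₁ e∈ with x∈p∪q⁻ a b e∈
          ... | inj₁ e∈a = inj₁ (⊆-∪ˡ e∈a)
          ... | inj₂ e∈b = inj₂ (⊆-∪ˡ e∈b)
          cover* e | inj₂ e∈ with x∈p∪q⁻ (cluster O₁) (cluster O₂) e∈
          ... | inj₁ e∈₁ = inj₁ (⊆-∪ʳ e∈₁)
          ... | inj₂ e∈₂ = inj₂ (⊆-∪ʳ e∈₂)

      distribute₂-swapped : ∀ {O₁ O₂} → Valid O₁ → Valid O₂ →
        Disjoint (a ∪ b) (cluster O₁) → Disjoint (a ∪ b) (cluster O₂) →
        Disjoint (cluster O₁) (cluster O₂) → Covering (a ∪ b) (cluster O₁ ∪ cluster O₂) →
        Touching b (cluster O₁) → Touching a (cluster O₂) → Distribution A B (O₁ ∷ O₂ ∷ [])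
      distribute₂-swapped {O₁} {O₂} v₁ v₂ d₁ d₂ d₁₂ cover t₁ t₂ = record
        { Distribution D; parts = ↭-trans (↭-swap O₁ O₂ ↭-refl) (Distribution.parts D) }
        where
        D : Distribution A B (O₂ ∷ O₁ ∷ [])
        D = distribute₂ v₂ v₁ d₂ d₁ (disjoint-sym d₁₂)
              (λ e → [ inj₁ , inj₂ ∘ x∈p∪q⁺ ∘ swap ∘ x∈p∪q⁻ _ _ ]′ (cover e)) t₂ t₁

      -- Two attachment vertices in X and the vertex shared with Y would give X
      -- three boundary vertices, so Y contains one of the two.
      attached-to-both : ∀ {X Y O₁ O₂} → Valid X → Disjoint (cluster X) Y → Touching (cluster X) Y →
        Disjoint (cluster X) O₁ → Disjoint (cluster X) O₂ →
        (t₁ : Touching (cluster X) O₁) (t₂ : Touching (cluster X) O₂) → proj₁ t₁ ≢ proj₁ t₂ →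
        Touching Y O₁ ⊎ Touching Y O₂
      attached-to-both vX X∩Y (z , zX , zY) X∩O₁ X∩O₂ (z₁ , z₁X , z₁O) (z₂ , z₂X , z₂O) z₁≢z₂
        with no-third-member (proj₂ (proj₂ (valid⇒cluster vX))) z₁≢z₂
               (∈∂ X∩O₁ z₁X z₁O) (∈∂ X∩O₂ z₂X z₂O) (∈∂ X∩Y zX zY)
      ... | inj₁ refl = inj₁ (z , zY , z₁O)
      ... | inj₂ refl = inj₂ (z , zY , z₂O)

    distribute : ∀ {Os} → Outside (A ▵ B) Os → Distribution A B Os
    distribute (whole all) = distribution alone alone ↭-refl a∩b (x∈p∪q⁻ a b ∘ all)
    distribute (one {O} v c∩o (z , zC , zO) cover) with V-∪⁻ a b zC
    ... | inj₁ zA = distribution (with-part v (disjoint-⊆ˡ ⊆-∪ˡ c∩o) (z , zA , zO)) alone ↭-refl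
      (disjoint-∪ˡ a∩b (disjoint-sym (disjoint-⊆ˡ ⊆-∪ʳ c∩o)))
      (λ e → [ [ inj₁ ∘ ⊆-∪ˡ , inj₂ ]′ ∘ x∈p∪q⁻ a b , inj₁ ∘ ⊆-∪ʳ ]′ (cover e))
    ... | inj₂ zB = distribution alone (with-part v (disjoint-⊆ˡ ⊆-∪ʳ c∩o) (z , zB , zO)) ↭-refl
      (disjoint-∪ʳ a∩b (disjoint-⊆ˡ ⊆-∪ˡ c∩o))
      (λ e → [ [ inj₁ , inj₂ ∘ ⊆-∪ˡ ]′ ∘ x∈p∪q⁻ a b , inj₂ ∘ ⊆-∪ʳ ]′ (cover e))
    distribute (two {O₁} {O₂} v₁ v₂ d₁ d₂ d₁₂ (z₁ , z₁C , z₁O) (z₂ , z₂C , z₂O) z₁≢z₂ cover)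
      with V-∪⁻ a b z₁C | V-∪⁻ a b z₂C
    ... | inj₁ z₁A | inj₂ z₂B = distribute₂ v₁ v₂ d₁ d₂ d₁₂ cover (z₁ , z₁A , z₁O) (z₂ , z₂B , z₂O)
    ... | inj₂ z₁B | inj₁ z₂A = distribute₂-swapped v₁ v₂ d₁ d₂ d₁₂ cover (z₁ , z₁B , z₁O) (z₂ , z₂A , z₂O)
    -- Both parts hang on `A`. The vertex shared with `B` is one of the two attachment vertices, and
    -- the part attached there goes to `B`.
    ... | inj₁ z₁A | inj₁ z₂A
      with attached-to-both vA a∩b a·b (disjoint-⊆ˡ ⊆-∪ˡ d₁) (disjoint-⊆ˡ ⊆-∪ˡ d₂)
             (z₁ , z₁A , z₁O) (z₂ , z₂A , z₂O) z₁≢z₂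
    ...   | inj₁ t₁ = distribute₂-swapped v₁ v₂ d₁ d₂ d₁₂ cover t₁ (z₂ , z₂A , z₂O)
    ...   | inj₂ t₂ = distribute₂ v₁ v₂ d₁ d₂ d₁₂ cover (z₁ , z₁A , z₁O) t₂
    distribute (two {O₁} {O₂} v₁ v₂ d₁ d₂ d₁₂ (z₁ , z₁C , z₁O) (z₂ , z₂C , z₂O) z₁≢z₂ cover)
        | inj₂ z₁B | inj₂ z₂B
      with attached-to-both vB (disjoint-sym a∩b) (touching-sym a·b)
             (disjoint-⊆ˡ ⊆-∪ʳ d₁) (disjoint-⊆ˡ ⊆-∪ʳ d₂)
             (z₁ , z₁B , z₁O) (z₂ , z₂B , z₂O) z₁≢z₂
    ...   | inj₁ t₁ = distribute₂ v₁ v₂ d₁ d₂ d₁₂ cover t₁ (z₂ , z₂B , z₂O)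
    ...   | inj₂ t₂ = distribute₂-swapped v₁ v₂ d₁ d₂ d₁₂ cover (z₁ , z₁B , z₁O) t₂

  -- Cut bounds, regrouping and the cost of a search.

  module _ (guide : Guide) where
    open Guide guide

    good? : ∀ C → Dec (Good C)
    good? C = any? λ e → (e ∈? C) ×-dec target? e

    cut-bound : ∀ {C D} → Connected C → Connected D → Disjoint C D → Covering C D → Touching C D →
      Good D → ∣ ∂ C ∣ ≤ 2
    cut-bound cC cD C∩D C+D t gD = ∣∂∣≤2-cut cC cD C∩D C+D t (few cC C∩D gD)

    -- Afterwards everything outside `A` consists of `B*` and the parts in `GA`, as `regroup`
    -- expects.
    join-sibling : ∀ {A B B* Os GA GB} → Os ↭ GA ++ GB → Extended B B* GB → Valid B* →
      Reach (A ∷ B ∷ Os) 1 (A ∷ B* ∷ GA)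
    join-sibling {A} {B} {B*} {Os} {GA} {GB} p ext vB* =
      reach-↭ (↭-trans (↭-swap A B (↭-trans p (++-comm GA GB))) (↭-prep B (↭-sym (shift A GB GA))))
      ⨾ extend ext vB* ⨾ reach-↭ (↭-swap B* A ↭-refl)

    -- If D and the part extending A are attached to A at the same vertex, they
    -- become one part.
    regroup : ∀ {A A* D Os} → Valid A → Good (cluster A) → Extended A A* Os → Valid D →
      Disjoint (cluster A*) (cluster D) → Covering (cluster A*) (cluster D) →
      Touching (cluster A) (cluster D) →
      ∃ λ Os′ → Reach (A ∷ D ∷ Os) 1 (A ∷ Os′) × Outside A Os′
    regroup {D = D} vA gA alone vD A∩D A+D t =
      [ D ] , reach-weaken z≤n (reach-↭ ↭-refl) , one vD A∩D t A+D
    regroup {A} {D = D} vA gA (with-part {O} vO A∩O (o , oA , oO)) vD A*∩D A*+D (z , zA , zD) = by-vertex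
      where
      A∩D : Disjoint (cluster A) (cluster D)
      A∩D = disjoint-⊆ˡ ⊆-∪ˡ A*∩D
      D∩O : Disjoint (cluster D) (cluster O)
      D∩O = disjoint-sym (disjoint-⊆ˡ ⊆-∪ʳ A*∩D)
      cover : Covering (cluster A) (cluster D ∪ cluster O)
      cover e with A*+D e
      ... | inj₂ e∈D = inj₂ (⊆-∪ˡ e∈D)
      ... | inj₁ e∈ with x∈p∪q⁻ (cluster A) (cluster O) e∈
      ...   | inj₁ e∈A = inj₁ e∈A
      ...   | inj₂ e∈O = inj₂ (⊆-∪ʳ e∈O)
      cA = valid⇒connected vA
      by-vertex : ∃ λ Os′ → Reach (A ∷ D ∷ [ O ]) 1 (A ∷ Os′) × Outside A Os′
      by-vertex with z ≟ o
      ... | no z≢o = D ∷ [ O ] , reach-weaken z≤n (reach-↭ ↭-refl) ,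
        two vD vO A∩D A∩O D∩O (z , zA , zD) (o , oA , oO) z≢o cover
      ... | yes refl = [ D ▵ O ] ,
        (reach-↭ (↭-trans (↭-swap A D ↭-refl) (↭-prep D (↭-swap A O ↭-refl))) ⨾ reach-join vDO ⨾
          reach-↭ (↭-swap (D ▵ O) A ↭-refl)) ,
        one vDO A∩DO (z , zA , V-mono ⊆-∪ˡ zD) cover
        where
        A∩DO : Disjoint (cluster A) (cluster D ∪ cluster O)
        A∩DO = disjoint-∪ʳ A∩D A∩O
        vDO : Valid (D ▵ O)
        -- `D ▵ O` is the complement of the good cluster `A`, which bounds its boundary.
        vDO = valid-▵ vD vO D∩O (z , zD , oO)
          (cut-bound (connected-∪ (valid⇒connected vD) (valid⇒connected vO) (z , zD , oO)) cA
            (disjoint-sym A∩DO) (swap ∘ cover) (z , V-mono ⊆-∪ˡ zD , zA) gA)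

    -- Uniqueness is claimed only among the edges of the current cluster, which makes the statement
    -- inductive; at the root it covers all of `T`.
    record Answers (C : Subset m) (b : ℕ) (o : Outcome) : Set where
      field
        within : calls o ≤ b
        inC    : returned o ∈ˢ C
        target : Target (returned o)
        common : All (returned o ∈ˢ_) (chosen o)
        sole   : ∀ {e} → e ∈ˢ C → Target e → All (e ∈ˢ_) (chosen o) → e ≡ returned o

    Result : Forest → Binary m → ℕ → Set
    Result F C b = Σ (Search F C) λ s → ∀ select → Answers (cluster C) b (run select s)

    answers-≤ : ∀ {C b b′ o} → b ≤ b′ → Answers C b o → Answers C b′ o
    answers-≤ b≤b′ ans = record { Answers ans; within = ≤-trans (Answers.within ans) b≤b′ }

    answers-descend : ∀ {C A B b o} → A ⊆ C → (∀ {e} → e ∈ˢ C → e ∈ˢ A ⊎ e ∈ˢ B) → ¬ Good B →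
      Answers A b o → Answers C b o
    answers-descend A⊆C A+B ¬gB ans = record
      { within = within
      ; inC    = A⊆C inC
      ; target = target
      ; common = common
      ; sole   = λ e∈C te e∈all → [ (λ e∈A → sole e∈A te e∈all) , (λ e∈B → contradiction (_ , e∈B , te) ¬gB) ]′ (A+B e∈C)
      }
      where open Answers ans

    -- As `A*` and `B*` are disjoint, the chosen one meets `A ∪ B` exactly in the chosen child, so
    -- the new entry of `chosen` confines common edges to that child.
    answers-call : ∀ {A B A* B*} → cluster A ⊆ cluster A* → cluster B ⊆ cluster B* →
      Disjoint (cluster A*) (cluster B*) → ∀ k {b} s (o : Outcome) → Answers (cluster (pick s A B)) b o →
      Answers (cluster (A ▵ B)) (k + suc b)
        (outcome (returned o) (cluster (pick s A* B*) ∷ chosen o) (k + suc (calls o)) (final o))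
    answers-call {A} {B} A⊆ B⊆ A*∩B* k s o ans = record
      { within = +-monoʳ-≤ k (s≤s within)
      ; inC    = in-either s inC
      ; target = target
      ; common = in-chosen s inC ∷ common
      ; sole   = λ { e∈C te (e∈s ∷ e∈all) → sole (from-chosen s (x∈p∪q⁻ _ _ e∈C) e∈s) te e∈all }
      }
      where
      open Answers ans
      in-either : ∀ s {e} → e ∈ˢ cluster (pick s A B) → e ∈ˢ cluster (A ▵ B)
      in-either first  = ⊆-∪ˡ
      in-either second = ⊆-∪ʳ
      in-chosen : ∀ s {e} → e ∈ˢ cluster (pick s A B) → e ∈ˢ cluster (pick s _ _)
      in-chosen first  = A⊆
      in-chosen second = B⊆
      from-chosen : ∀ s {e} → e ∈ˢ cluster A ⊎ e ∈ˢ cluster B → e ∈ˢ cluster (pick s _ _) →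
        e ∈ˢ cluster (pick s A B)
      from-chosen first  (inj₁ e∈A) _   = e∈A
      from-chosen first  (inj₂ e∈B) e∈s = ⊥-elim (A*∩B* e∈s (B⊆ e∈B))
      from-chosen second (inj₁ e∈A) e∈s = ⊥-elim (A*∩B* (A⊆ e∈A) e∈s)
      from-chosen second (inj₂ e∈B) _   = e∈B

    height-pick : ∀ s (A B : Binary m) → height (pick s A B) ≤ height A ⊔ height B
    height-pick first  A B = m≤m⊔n (height A) (height B)
    height-pick second A B = m≤n⊔m (height A) (height B)

    -- `next` has to serve both answers, because the strategy is fixed before `select` is known.
    call-result : ∀ {F F′ A B A* B*} →
      ∣ ∂T ∣ ≤ 1 ⊎ (PathChild (cluster (A ▵ B)) (cluster A) × PathChild (cluster (A ▵ B)) (cluster B)) →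
      (ops : Steps F F′) → (A* ▵ B*) ∈ F′ → cluster A ⊆ cluster A* → cluster B ⊆ cluster B* →
      Disjoint (cluster A*) (cluster B*) → Covering (cluster A*) (cluster B*) →
      ∀ {l b} → (∀ s → count ops + suc (l + 8 * height (pick s A B)) ≤ b) →
      (∀ s → Result F′ (pick s A B) (l + 8 * height (pick s A B))) → Result F (A ▵ B) b
    call-result {A = A} {B} {A*} {B*} allowed ops root A⊆ B⊆ A*∩B* A*+B* bound next =
      call allowed ops root A⊆ B⊆ (covering⇒∪≡⊤ A*+B*) (proj₁ ∘ next) ,
      λ select → let s = select A* B* in
        answers-≤ (bound s) (answers-call {A} {B} {A*} {B*} A⊆ B⊆ A*∩B* (count ops) s _ (proj₂ (next s) select))

    -- The pending steps leading from F to C ∷ Os are carried along, because a descent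
    -- without a call of select leaves the forest F as it is.
    Solvable : Binary m → Set
    Solvable C = ∀ {F Os k} → Good (cluster C) → Reach F k (C ∷ Os) → Outside C Os →
      Result F C (k + 8 * height C)

    -- Each level of the top tree costs at most 4 steps before the call of select,
    -- the call itself, and 3 steps after it.
    level : ∀ s A B {i} → i ≤ 8 → i + 8 * height (pick s A B) ≤ 8 * height (A ▵ B)
    level s A B i≤8 = ≤-trans (+-mono-≤ i≤8 (*-monoʳ-≤ 8 (height-pick s A B)))
      (≤-reflexive (sym (*-suc 8 (height A ⊔ height B))))

    -- Three steps join the pending ones: splitting `A ▵ B`, extending the sibling, and regrouping.
    descent-cost : ∀ k s A B → (k + 2) + 1 + 8 * height (pick s A B) ≤ k + 8 * height (A ▵ B)
    descent-cost k s A B = ≤-trans (≤-reflexive (trans (cong (_+ 8 * height (pick s A B)) (+-assoc k 2 1)) (+-assoc k 3 _)))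
      (+-monoʳ-≤ k (level s A B (m≤m+n 3 5)))

    call-cost : ∀ {j k} → j ≤ k + 4 → ∀ s A B → j + suc (3 + 8 * height (pick s A B)) ≤ k + 8 * height (A ▵ B)
    call-cost {j} {k} j≤ s A B = ≤-trans (+-monoˡ-≤ _ j≤)
      (≤-trans (≤-reflexive (+-assoc k 4 _)) (+-monoʳ-≤ k (level s A B ≤-refl)))

    solve-regrouped : ∀ {C F Os k} → Solvable C → Good (cluster C) → Reach F k (C ∷ Os) →
      (∃ λ Os′ → Reach (C ∷ Os) 1 (C ∷ Os′) × Outside C Os′) → Result F C (k + 1 + 8 * height C)
    solve-regrouped solveC gC pending (_ , r , out) = solveC gC (pending ⨾ r) out

    descend₁-result : ∀ {F A B b b′} → b ≤ b′ → ¬ Good (cluster B) →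
      ∣ ∂T ∣ ≡ 2 × PathChild (cluster (A ▵ B)) (cluster A) × ¬ PathChild (cluster (A ▵ B)) (cluster B) →
      Result F A b → Result F (A ▵ B) b′
    descend₁-result b≤b′ ¬gB (∣∂T∣≡2 , pcA , ¬pcB) (s , answers) =
      descend₁ ∣∂T∣≡2 pcA ¬pcB s , λ select →
        answers-≤ b≤b′ (answers-descend ⊆-∪ˡ (x∈p∪q⁻ _ _) ¬gB (answers select))

    descend₂-result : ∀ {F A B b b′} → b ≤ b′ → ¬ Good (cluster A) →
      ∣ ∂T ∣ ≡ 2 × PathChild (cluster (A ▵ B)) (cluster B) × ¬ PathChild (cluster (A ▵ B)) (cluster A) →
      Result F B b → Result F (A ▵ B) b′
    descend₂-result b≤b′ ¬gA (∣∂T∣≡2 , pcB , ¬pcA) (s , answers) =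
      descend₂ ∣∂T∣≡2 ¬pcA pcB s , λ select →
        answers-≤ b≤b′ (answers-descend ⊆-∪ʳ (swap ∘ x∈p∪q⁻ _ _) ¬gA (answers select))

    -- One level of the descent.

    module Level {A B : Binary m} (vA : Valid A) (vB : Valid B) (A-B : Neighbours (cluster A) (cluster B))
      (cAB : IsCluster (cluster (A ▵ B))) (solveA : Solvable A) (solveB : Solvable B)
      {A* B* : Binary m} {GA GB : Forest} (extA : Extended A A* GA) (extB : Extended B B* GB)
      (disjoint* : Disjoint (cluster A*) (cluster B*)) (covering* : Covering (cluster A*) (cluster B*)) where
      private
        cA* : Connected (cluster A*)
        cA* = extended-connected vA extA
        cB* : Connected (cluster B*)
        cB* = extended-connected vB extB

        t : Touching (cluster A) (cluster B)
        t = neighbours⇒touching A-B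

        t* : Touching (cluster A*) (cluster B*)
        t* = touching-⊆ (extended-⊆ extA) (extended-⊆ extB) t

        -- Each extended child is a cluster because the other child is good: a target beyond the cut
        -- leaves at most one vertex of `∂T` on the near side.
        vA* : Good (cluster B) → Valid A*
        vA* gB = extended-valid vA extA
          (cut-bound cA* cB* disjoint* covering* t* (good-⊆ (extended-⊆ extB) gB))

        vB* : Good (cluster A) → Valid B*
        vB* gA = extended-valid vB extB
          (cut-bound cB* cA* (disjoint-sym disjoint*) (swap ∘ covering*) (touching-sym t*)
            (good-⊆ (extended-⊆ extA) gA))

        regroupA : Good (cluster A) → ∃ λ Os′ → Reach (A ∷ B* ∷ GA) 1 (A ∷ Os′) × Outside A Os′
        regroupA gA = regroup vA gA extA (vB* gA) disjoint* covering* (touching-⊆ id (extended-⊆ extB) t)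

        regroupB : Good (cluster B) → ∃ λ Os′ → Reach (B ∷ A* ∷ GB) 1 (B ∷ Os′) × Outside B Os′
        regroupB gB = regroup vB gB extB (vA* gB) (disjoint-sym disjoint*) (swap ∘ covering*)
          (touching-⊆ id (extended-⊆ extA) (touching-sym t))

      solve-both : ∀ {F Os k} → Os ↭ GA ++ GB → Reach F k ((A ▵ B) ∷ Os) →
        Good (cluster A) → Good (cluster B) → Result F (A ▵ B) (k + 8 * height (A ▵ B))
      solve-both {F} {Os} {k} parts pending gA gB = from-root rooted
        where
        v* : Valid (A* ▵ B*)
        -- The union is all of `T`, whose boundary lies in `∂T`.
        v* = valid-▵ (vA* gB) (vB* gA) disjoint* t*
          (≤-trans (p⊆q⇒∣p∣≤∣q∣ (∂-full (covering⇒∪≡⊤ covering*))) ∣∂T∣≤2)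

        -- The four steps: split `A ▵ B`, extend `B`, extend `A`, join the results.
        rooted : Reach F (k + 4) [ A* ▵ B* ]
        rooted = pending ⨾ reach-split ⨾ join-sibling parts extB (vB* gA) ⨾
          reach-↭ (↭-prep A (++-comm [ B* ] GA)) ⨾ extend extA (vA* gB) ⨾ reach-join v*

        -- Two steps undo the root join and the extension of the chosen child; the third regroups
        -- what lies outside it.
        next : ∀ s → Result [ A* ▵ B* ] (pick s A B) (3 + 8 * height (pick s A B))
        next first = solve-regrouped solveA gA
          (reach-split ⨾ retract extA ⨾ reach-↭ (↭-prep A (++-comm GA [ B* ]))) (regroupA gA)
        next second = solve-regrouped solveB gB
          (reach-split ⨾ reach-↭ (↭-swap A* B* ↭-refl) ⨾ retract extB ⨾ reach-↭ (↭-prep B (++-comm GB [ A* ])))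
          (regroupB gB)

        from-root : Reach F (k + 4) [ A* ▵ B* ] → Result F (A ▵ B) (k + 8 * height (A ▵ B))
        -- A permutation of a singleton is that singleton, so the forest reached is literally
        -- `[ A* ▵ B* ]`.
        from-root (reach ops ops≤ p) with refl ← ↭-singleton-inv p =
          call-result (callable cAB ⊆-∪ˡ ⊆-∪ʳ gA gB) ops (here refl) (extended-⊆ extA) (extended-⊆ extB)
            disjoint* covering* {l = 3} (λ s → call-cost ops≤ s A B) next

      -- Only `B` is extended, which the goodness of `A` permits; `A*` need not be a cluster here.
      solve-first : ∀ {F Os k} → Os ↭ GA ++ GB → Reach F k ((A ▵ B) ∷ Os) →
        Good (cluster A) → ¬ Good (cluster B) → Result F (A ▵ B) (k + 8 * height (A ▵ B))
      solve-first {k = k} parts pending gA ¬gB =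
        descend₁-result (descent-cost k first A B) ¬gB
          (forced cAB ⊆-∪ˡ ⊆-∪ʳ (proj₁ (valid⇒cluster vB)) gA ¬gB)
          (solve-regrouped solveA gA (pending ⨾ reach-split ⨾ join-sibling parts extB (vB* gA)) (regroupA gA))

      solve-second : ∀ {F Os k} → Os ↭ GA ++ GB → Reach F k ((A ▵ B) ∷ Os) →
        ¬ Good (cluster A) → Good (cluster B) → Result F (A ▵ B) (k + 8 * height (A ▵ B))
      solve-second {k = k} parts pending ¬gA gB =
        descend₂-result (descent-cost k second A B) ¬gA
          (forced cAB ⊆-∪ʳ ⊆-∪ˡ (proj₁ (valid⇒cluster vA)) gB ¬gA)
          (solve-regrouped solveB gB
            (pending ⨾ reach-split ⨾ reach-↭ (↭-swap A B ↭-refl) ⨾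
              join-sibling (↭-trans parts (++-comm GA GB)) extA (vA* gB))
            (regroupB gB))

    -- The induction over the top tree, and its restoration.

    solve : ∀ {C} → Valid C → Solvable C
    -- The pending steps are dropped: no further call of select will follow.
    solve (leaf {e} _) (e′ , e′∈e , te′) _ _ = found , λ select → record
      { within = z≤n
      ; inC    = x∈⁅x⁆ e
      ; target = subst Target (x∈⁅y⁆⇒x≡y e e′∈e) te′
      ; common = []
      ; sole   = λ f∈e _ _ → x∈⁅y⁆⇒x≡y e f∈e
      }
    solve (node {A} {B} vA vB A-B cAB) (e , e∈ , te) pending out
      with distribution extA extB parts disjoint* covering* ← distribute vA vB A-B out
         | good? (cluster A) | good? (cluster B)
    ... | yes gA | yes gB = solve-both parts pending gA gB
      where open Level vA vB A-B cAB (solve vA) (solve vB) extA extB disjoint* covering*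
    ... | yes gA | no ¬gB = solve-first parts pending gA ¬gB
      where open Level vA vB A-B cAB (solve vA) (solve vB) extA extB disjoint* covering*
    ... | no ¬gA | yes gB = solve-second parts pending ¬gA gB
      where open Level vA vB A-B cAB (solve vA) (solve vB) extA extB disjoint* covering*
    -- A target of the union lies in one of the children, so one of them is good.
    ... | no ¬gA | no ¬gB with x∈p∪q⁻ _ _ e∈
    ...   | inj₁ e∈A = contradiction (e , e∈A , te) ¬gA
    ...   | inj₂ e∈B = contradiction (e , e∈B , te) ¬gB

    restore : ∀ {F R k} → Reach F k [ R ] → Σ (Steps F [ R ]) λ ops → count ops ≤ k
    restore (reach s b p) with refl ← ↭-singleton-inv p = s , b

    -- The traced steps are at most as many as all calls, so undoing them stays within the same
    -- bound `b`.
    result⇒solves : ∀ {R b} → Valid R → (∀ e → e ∈ˢ cluster R) → Result [ R ] R b → ∃ λ search → Solves Target b R search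
    result⇒solves vR R∋ (search , answers) = search , λ select →
      let open Answers (answers select)
          ops , ops≤ = trace select search
      in within , (target , common) , (λ e (te , e∈all) → sole (R∋ e) te e∈all) ,
         restore (reach-weaken (≤-trans ops≤ within) (undo (vR ∷ []) ops))

    solves : ∀ {R} → IsTopTree R → Good full → ∃ λ search → Solves Target (8 * height R) R search
    solves {R} (vR , R≡⊤) g =
      result⇒solves vR R∋ (solve vR (good-⊆ (λ {e} _ → R∋ e) g) (reach-↭ ↭-refl) (whole R∋))
      where
      R∋ : ∀ e → e ∈ˢ cluster R
      R∋ e = subst (e ∈ˢ_) (sym R≡⊤) ∈⊤

-- Two external boundary vertices: targets on the path between them.

module OnPath {n m : ℕ} (T : Tree n m) (∂T : Subset n) (∣∂T∣≤2 : ∣ ∂T ∣ ≤ 2)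
  {x y : Fin n} (x≢y : x ≢ y) (∂T≡xy : ∂T ≡ ⁅ x ⁆ ∪ ⁅ y ⁆) where
  open Tree T
  open Walks graph
  open TopTrees T ∂T
  open TreeWalks T
  open Descent T ∂T ∣∂T∣≤2 (_∈ pathEdges x y)

  x∈∂T : x ∈ˢ ∂T
  x∈∂T = subst (x ∈ˢ_) (sym ∂T≡xy) (⊆-∪ˡ (x∈⁅x⁆ x))

  y∈∂T : y ∈ˢ ∂T
  y∈∂T = subst (y ∈ˢ_) (sym ∂T≡xy) (⊆-∪ʳ (x∈⁅x⁆ y))

  few : ∀ {C D} → Connected C → Disjoint C D → Good D → ∣ V C ∩ ∂T ∣ ≤ 1
  few {C} cC C∩D (e , e∈D , e∈p) with x ∈? V C | y ∈? V C
  ... | yes xC | yes yC = ⊥-elim (C∩D (pathEdges⊆ (cC xC yC) e∈p) e∈D)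
  ... | no x∉C | _ = ≤-trans (p⊆q⇒∣p∣≤∣q∣ ⊆y) (≤-reflexive (∣⁅x⁆∣≡1 y))
    where
    ⊆y : V C ∩ ∂T ⊆ ⁅ y ⁆
    ⊆y z∈ with zC , z∈∂T ← x∈p∩q⁻ (V C) ∂T z∈ with x∈p∪q⁻ ⁅ x ⁆ ⁅ y ⁆ (subst (_ ∈ˢ_) ∂T≡xy z∈∂T)
    ... | inj₁ z∈x = contradiction (subst (_∈ˢ V C) (x∈⁅y⁆⇒x≡y x z∈x) zC) x∉C
    ... | inj₂ z∈y = z∈y
  ... | _ | no y∉C = ≤-trans (p⊆q⇒∣p∣≤∣q∣ ⊆x) (≤-reflexive (∣⁅x⁆∣≡1 x))
    where
    ⊆x : V C ∩ ∂T ⊆ ⁅ x ⁆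
    ⊆x z∈ with zC , z∈∂T ← x∈p∩q⁻ (V C) ∂T z∈ with x∈p∪q⁻ ⁅ x ⁆ ⁅ y ⁆ (subst (_ ∈ˢ_) ∂T≡xy z∈∂T)
    ... | inj₁ z∈x = z∈x
    ... | inj₂ z∈y = contradiction (subst (_∈ˢ V C) (x∈⁅y⁆⇒x≡y y z∈y) zC) y∉C

  -- The cluster path as the stretch of the path from `x` to `y` inside `C`. `within` and `covers`
  -- together make good children and path children the same.
  record ClusterPath (C : Subset m) : Set where
    field
      {a b}  : Fin n
      a≢b    : a ≢ b
      ∂C≡ab  : ∂ C ≡ ⁅ a ⁆ ∪ ⁅ b ⁆
      within : ∀ {e} → e ∈ pathEdges a b → e ∈ pathEdges x y
      covers : ∀ {e} → e ∈ˢ C → e ∈ pathEdges x y → e ∈ pathEdges a b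

  boundary-end : ∀ {C u v} → u ∈ˢ V C → v ∈ˢ ∂T → u ≡ v ⊎ u ∈ˢ V (∁ C) → u ∈ˢ ∂ C
  boundary-end uC v∈∂T (inj₁ refl) = x∈p∩q⁺ (uC , ⊆-∪ˡ v∈∂T)
  boundary-end uC v∈∂T (inj₂ u∈∁)  = x∈p∩q⁺ (uC , ⊆-∪ʳ u∈∁)

  -- The two ends differ because the path between them still contains `e`; being boundary vertices,
  -- they then exhaust `∂ C`.
  trimmed⇒clusterPath : ∀ {C e} → ∣ ∂ C ∣ ≤ 2 → e ∈ˢ C → e ∈ pathEdges x y →
    (front : Trimmed C x y) → Trimmed C y (Trimmed.end front) → ClusterPath C
  trimmed⇒clusterPath {C} bd e∈C e∈xy (trimmed {a} aC a-end keep-a sub-a) (trimmed {b} bC b-end keep-b sub-b) = record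
    { a≢b    = a≢b
    ; ∂C≡ab  = members bd a≢b (boundary-end aC x∈∂T a-end) (boundary-end bC y∈∂T b-end)
    -- The second trimming starts from `y`, so the path is turned around before and after it.
    ; within = sub-a ∘ pathEdges-sym ∘ sub-b ∘ pathEdges-sym
    ; covers = covers
    }
    where
    covers : ∀ {f} → f ∈ˢ C → f ∈ pathEdges x y → f ∈ pathEdges a b
    covers f∈C f∈xy = pathEdges-sym (keep-b f∈C (pathEdges-sym (keep-a f∈C f∈xy)))
    a≢b : a ≢ b
    a≢b = pathEdges⇒≢ (covers e∈C e∈xy)

  -- Cut the path from x to y back to its first edge in C, and then, from the
  -- other end, to its last one: both new ends are boundary vertices of C.
  clusterPath : ∀ {C} → ∣ ∂ C ∣ ≤ 2 → Good C → ClusterPath C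
  clusterPath {C} bd (e , e∈C , e∈xy) = trimmed⇒clusterPath bd e∈C e∈xy front
    (trim C e∈C (pathEdges-sym (Trimmed.keeps front e∈C e∈xy)))
    where
    front : Trimmed C x y
    front = trim C e∈C e∈xy

  -- `PathChild` may name the two boundary vertices in either order.
  ends-of-pair : ∀ {a b c d : Fin n} → c ≢ d → ⁅ a ⁆ ∪ ⁅ b ⁆ ≡ ⁅ c ⁆ ∪ ⁅ d ⁆ → (c ≡ a × d ≡ b) ⊎ (c ≡ b × d ≡ a)
  ends-of-pair {a} {b} {c} {d} c≢d eq
    with x∈p∪q⁻ ⁅ a ⁆ ⁅ b ⁆ (subst (c ∈ˢ_) (sym eq) (⊆-∪ˡ (x∈⁅x⁆ c)))
       | x∈p∪q⁻ ⁅ a ⁆ ⁅ b ⁆ (subst (d ∈ˢ_) (sym eq) (⊆-∪ʳ (x∈⁅x⁆ d)))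
  ... | inj₁ c∈a | inj₂ d∈b = inj₁ (x∈⁅y⁆⇒x≡y a c∈a , x∈⁅y⁆⇒x≡y b d∈b)
  ... | inj₂ c∈b | inj₁ d∈a = inj₂ (x∈⁅y⁆⇒x≡y b c∈b , x∈⁅y⁆⇒x≡y a d∈a)
  ... | inj₁ c∈a | inj₁ d∈a = contradiction (trans (x∈⁅y⁆⇒x≡y a c∈a) (sym (x∈⁅y⁆⇒x≡y a d∈a))) c≢d
  ... | inj₂ c∈b | inj₂ d∈b = contradiction (trans (x∈⁅y⁆⇒x≡y b c∈b) (sym (x∈⁅y⁆⇒x≡y b d∈b))) c≢d

  good⇒pathChild : ∀ {C A} → ClusterPath C → A ⊆ C → Good A → PathChild C A
  good⇒pathChild cp A⊆C (e , e∈A , e∈xy) = a , b , a≢b , ∂C≡ab , e , e∈A , covers (A⊆C e∈A) e∈xy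
    where open ClusterPath cp

  pathChild⇒good : ∀ {C A} → ClusterPath C → PathChild C A → Good A
  pathChild⇒good cp (c , d , c≢d , ∂C≡cd , e , e∈A , e∈cd) = e , e∈A , within e∈ab
    where
    open ClusterPath cp
    e∈ab : e ∈ pathEdges a b
    e∈ab with ends-of-pair c≢d (trans (sym ∂C≡ab) ∂C≡cd)
    ... | inj₁ (refl , refl) = e∈cd
    ... | inj₂ (refl , refl) = pathEdges-sym e∈cd

  guide : Guide
  guide = record
    { target?  = λ e → DecMembership._∈?_ _≟_ e (pathEdges x y)
    ; few      = few
    ; callable = λ (_ , _ , bd) A⊆C B⊆C gA gB →
        let cp = clusterPath bd (good-⊆ A⊆C gA)
        in inj₂ (good⇒pathChild cp A⊆C gA , good⇒pathChild cp B⊆C gB)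
    ; forced   = λ (_ , _ , bd) A⊆C _ _ gA ¬gB →
        let cp = clusterPath bd (good-⊆ A⊆C gA)
        in ≤-antisym ∣∂T∣≤2 (two-members x≢y x∈∂T y∈∂T) , good⇒pathChild cp A⊆C gA , ¬gB ∘ pathChild⇒good cp
    }

-- At most one external boundary vertex, and the theorem.

anywhere : ∀ {n m} (T : Tree n m) (∂T : Subset n) (∣∂T∣≤2 : ∣ ∂T ∣ ≤ 2) → ∣ ∂T ∣ ≤ 1 →
  Descent.Guide T ∂T ∣∂T∣≤2 (λ _ → ⊤)
anywhere T ∂T _ ∣∂T∣≤1 = record
  { target?  = λ _ → yes tt
  ; few      = λ {C} _ _ _ → ≤-trans (∣p∩q∣≤∣q∣ (Walks.V (Tree.graph T) C) ∂T) ∣∂T∣≤1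
  ; callable = λ _ _ _ _ _ → inj₁ ∣∂T∣≤1
  -- Every nonempty set contains a target, so no level descends without calling select.
  ; forced   = λ _ _ _ (e , e∈B) _ ¬gB → contradiction (e , e∈B , tt) ¬gB
  }

theorem3p1 : ∃ λ (c : ℕ) → ∀ {n m : ℕ} (T : Tree n m) (∂T : Subset n) → ∣ ∂T ∣ ≤ 2 →
    let open TopTrees T ∂T in
    (R : Binary m) → IsTopTree R →
    (∣ ∂T ∣ ≤ 1 →
    ∃ λ search → Solves (λ _ → ⊤) (c * height R) R search)
    × (∀ (x y : Fin n) → x ≢ y → ∂T ≡ ⁅ x ⁆ ∪ ⁅ y ⁆ →
    ∃ λ search → Solves (λ e → e ∈ Tree.pathEdges T x y) (c * height R) R search)
theorem3p1 = 8 , λ T ∂T ∣∂T∣≤2 R top@(vR , _) →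
  (λ ∣∂T∣≤1 →
    -- An edge to search for exists because the root cluster is nonempty.
    let (e , _) , _ = Clusters.valid⇒cluster T ∂T vR
    in Descent.solves T ∂T ∣∂T∣≤2 (λ _ → ⊤) (anywhere T ∂T ∣∂T∣≤2 ∣∂T∣≤1) top (e , ∈⊤ , tt)) ,
  (λ x y x≢y ∂T≡xy →
    let e , e∈xy = TreeWalks.pathEdges-nonempty T x≢y
    in Descent.solves T ∂T ∣∂T∣≤2 (_∈ Tree.pathEdges T x y) (OnPath.guide T ∂T ∣∂T∣≤2 x≢y ∂T≡xy) top (e , ∈⊤ , e∈xy))
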